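{- Let $t>3$ be an odd integer and let $S=(1,2,2,2,\ldots)$, i.e. $a_1=1$ and $a_i=2$ for all $i\ge 2$. Then $\chi_S(G_t)=5$.
   Context: For an odd integer $t\ge 3$, $G_t$ denotes the integer distance graph $G(\mathbb{Z},\{2,t\})$: its vertex set is $\mathbb{Z}$, and distinct $i,j\in\mathbb{Z}$ are adjacent if and only if $|i-j|\in\{2,t\}$. For a graph $G$ and a non-decreasing sequence $S=(a_1,a_2,\ldots)$ of positive integers, an $S$-packing $k$-coloring of $G$ is a map $f:V(G)\to\{1,\ldots,k\}$ such that any two distinct vertices $u,v$ with $f(u)=f(v)=i$ satisfy $d_G(u,v)>a_i$, where $d_G$ is the shortest-path distance. The $S$-packing chromatic number $\chi_S(G)$ is the smallest $k$ for which $G$ has an $S$-packing $k$-coloring. -}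

module Defs where

open import Data.Nat using (ℕ; zero; suc; _+_; _≤_; _<_)
open import Data.Integer using (ℤ; ∣_∣; _-_)
open import Data.Fin using (Fin; toℕ)
open import Data.Product using (∃; Σ; _×_; _,_)
open import Data.Sum using (_⊎_)
open import Relation.Binary.PropositionalEquality using (_≡_; _≢_)
open import Relation.Nullary using (¬_)

Adj : ℕ → ℤ → ℤ → Set
Adj t i j = (∣ i - j ∣ ≡ 2) ⊎ (∣ i - j ∣ ≡ t)

data Walk (t : ℕ) : ℕ → ℤ → ℤ → Set where
  here : ∀ {i} → Walk t zero i i
  step : ∀ {n i j k} → Adj t i j → Walk t n j k → Walk t (suc n) i k

DistLe : ℕ → ℕ → ℤ → ℤ → Set
DistLe t k u v = ∃ λ n → (n ≤ k) × Walk t n u v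

-- S-packing k-coloring of G_t; S is given as a sequence a with colours
-- numbered 1..k; the colour c : Fin k stands for colour (toℕ c + 1).
IsSPackingColoring : (a : ℕ → ℕ) (t k : ℕ) → (ℤ → Fin k) → Set
IsSPackingColoring a t k f =
  ∀ u v → u ≢ v → f u ≡ f v → ¬ DistLe t (a (suc (toℕ (f u)))) u v

HasSPackingColoring : (a : ℕ → ℕ) (t k : ℕ) → Set
HasSPackingColoring a t k = Σ (ℤ → Fin k) (IsSPackingColoring a t k)

ChiSEq : (a : ℕ → ℕ) (t m : ℕ) → Set
ChiSEq a t m = HasSPackingColoring a t m × (∀ k → HasSPackingColoring a t k → m ≤ k)

-- S = (1, 2, 2, 2, ...), indexed from 1 (a 0 is irrelevant)
S122 : ℕ → ℕ
S122 zero = 1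
S122 (suc zero) = 1
S122 (suc (suc _)) = 2

{-# OPTIONS --safe #-}

-- Lower bound: the four neighbours of a vertex are pairwise at distance at
-- most 2, so with at most 4 colours one of them has colour 1.  Applied twice,
-- this gives two adjacent vertices of colour 1.
--
-- Upper bound: let c be the word of period 6 repeating 4 5 1 2 3 1 (colour i
-- is the element i − 1 of Fin 5).  If t ≡ ±1 (mod 6), then x ↦ c (x mod 6) is
-- a colouring.  Otherwise t = 6b + 9, and modulo n = 6b + 5 = t − 4, where h = 3b + 3 is the inverse of 2, the
-- differences 2, t, 4, t − 2, t + 2, 2t become 1, 2, 2, 1, 3, 4 after
-- multiplication by h.  Cutting c off at length n gives a cyclic word in which
-- equal letters are at distance at least 3, and at least 5 unless they are 1,
-- so x ↦ c (h x mod n) is a colouring.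

module Submission where

open import Defs
open import Data.Empty using (⊥)
open import Data.Fin using (Fin; zero; suc; toℕ; punchOut)
open import Data.Fin.Patterns using (0F; 1F; 2F; 3F; 4F)
open import Data.Fin.Properties using (any?; pigeonhole; punchOut-injective; <⇒≢) renaming (_≟_ to _≟ᶠ_)
open import Data.Integer as ℤ using (ℤ; +_; -[1+_]; ∣_∣; _%ℕ_; _/ℕ_)
import Data.Integer.DivMod as ℤ
import Data.Integer.Properties as ℤ
import Data.Integer.Tactic.RingSolver as ℤSolver
open import Data.Nat using (ℕ; zero; suc; _+_; _*_; _∸_; _≤_; _<_; _%_; _/_; NonZero; z≤n; s≤s; s<s⁻¹)
open import Data.Nat.DivMod using (m≡m%n+[m/n]*n; m<n⇒m%n≡m; [m+n]%n≡m%n; [m+kn]%n≡m%n)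
open import Data.Nat.Properties using (+-comm; +-assoc; +-cancelʳ-≡; +-cancelʳ-<; +-monoʳ-<; m∸n+n≡m; _<?_; _≤?_; ≰⇒>; ≮⇒≥; ≤-refl; ≤-trans; <-trans; m≤m+n)
import Data.Nat.Tactic.RingSolver as ℕSolver
open import Data.Product using (∃; _,_)
open import Data.Sum using (_⊎_; inj₁; inj₂; swap; [_,_]′) renaming (map to map-⊎)
open import Function using (_∘_)
open import Relation.Binary.PropositionalEquality using (_≡_; _≢_; refl; sym; trans; cong; cong₂; subst; module ≡-Reasoning)
open import Relation.Nullary using (yes; no; contradiction)

-- Lower bound

offset : ℕ → Fin 4 → ℤ
offset t 0F = + 2
offset t 1F = ℤ.- + 2
offset t 2F = + t
offset t 3F = ℤ.- + t

-- Opening `3 < t` exposes three successors in `t`, which makes the four offsets distinct normal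
-- forms.
offset-injective : ∀ t → 3 < t → ∀ i j → offset t i ≡ offset t j → i ≡ j
offset-injective _ _ 0F 0F _ = refl
offset-injective _ _ 1F 1F _ = refl
offset-injective _ _ 2F 2F _ = refl
offset-injective _ _ 3F 3F _ = refl
offset-injective _ (s≤s (s≤s (s≤s _))) 0F 1F ()
offset-injective _ (s≤s (s≤s (s≤s _))) 0F 2F ()
offset-injective _ (s≤s (s≤s (s≤s _))) 0F 3F ()
offset-injective _ (s≤s (s≤s (s≤s _))) 1F 0F ()
offset-injective _ (s≤s (s≤s (s≤s _))) 1F 2F ()
offset-injective _ (s≤s (s≤s (s≤s _))) 1F 3F ()
offset-injective _ (s≤s (s≤s (s≤s _))) 2F 0F ()
offset-injective _ (s≤s (s≤s (s≤s _))) 2F 1F ()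
offset-injective _ (s≤s (s≤s (s≤s _))) 2F 3F ()
offset-injective _ (s≤s (s≤s (s≤s _))) 3F 0F ()
offset-injective _ (s≤s (s≤s (s≤s _))) 3F 1F ()
offset-injective _ (s≤s (s≤s (s≤s _))) 3F 2F ()

∣offset∣ : ∀ t i → ∣ offset t i ∣ ≡ 2 ⊎ ∣ offset t i ∣ ≡ t
∣offset∣ t 0F = inj₁ refl
∣offset∣ t 1F = inj₁ refl
∣offset∣ t 2F = inj₂ refl
∣offset∣ t 3F = inj₂ (ℤ.∣-i∣≡∣i∣ (+ t))

neighbour : ℕ → ℤ → Fin 4 → ℤ
neighbour t u i = u ℤ.+ offset t i

[u+o]-u≡o : ∀ u o → (u ℤ.+ o) ℤ.- u ≡ o
[u+o]-u≡o = ℤSolver.solve-∀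

Adj-sym : ∀ {t} i j → Adj t i j → Adj t j i
Adj-sym i j = map-⊎ (trans (ℤ.∣i-j∣≡∣j-i∣ j i)) (trans (ℤ.∣i-j∣≡∣j-i∣ j i))

neighbour-adj : ∀ t u i → Adj t (neighbour t u i) u
neighbour-adj t u i = subst (λ o → ∣ o ∣ ≡ 2 ⊎ ∣ o ∣ ≡ t) (sym ([u+o]-u≡o u (offset t i))) (∣offset∣ t i)

neighbour-injective : ∀ t → 3 < t → ∀ u i j → neighbour t u i ≡ neighbour t u j → i ≡ j
neighbour-injective t 3<t u i j eq = offset-injective t 3<t i j
  (trans (sym ([u+o]-u≡o u _)) (trans (cong (ℤ._- u) eq) ([u+o]-u≡o u _)))

Adj⇒≢ : ∀ {t} → 3 < t → ∀ {u v} → Adj t u v → u ≢ v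
Adj⇒≢ 3<t {u} adj refl rewrite ℤ.+-inverseʳ u with inj₂ refl ← adj with () ← 3<t

S122≤2 : ∀ i → S122 i ≤ 2
S122≤2 0             = s≤s z≤n
S122≤2 1             = s≤s z≤n
S122≤2 (suc (suc _)) = ≤-refl

S122-nonzero : ∀ {k} (c : Fin (suc k)) → zero ≢ c → S122 (suc (toℕ c)) ≡ 2
S122-nonzero zero    0≢c = contradiction refl 0≢c
S122-nonzero (suc _) _   = refl

module _ {t k} (3<t : 3 < t) (k<4 : k < 4) (f : ℤ → Fin (suc k))
         (packing : IsSPackingColoring S122 t (suc k) f) where

  some-neighbour-zero : ∀ u → ∃ λ i → zero ≡ f (neighbour t u i)
  some-neighbour-zero u with any? (λ i → zero ≟ᶠ f (neighbour t u i))
  ... | yes found = found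
  ... | no none
    -- `punchOut` drops `zero` from the palette, leaving `k < 4` colours for four neighbours; two
    -- that share one are joined by a walk of length 2 through `u`.
    with i , j , i<j , eq ← pigeonhole k<4 (λ i → punchOut (none ∘ (i ,_)))
    = contradiction
        (2 , subst (2 ≤_) (sym (S122-nonzero _ (none ∘ (i ,_)))) (s≤s (s≤s z≤n))
           , step (neighbour-adj t u i) (step (Adj-sym _ u (neighbour-adj t u j)) here))
        (packing (neighbour t u i) (neighbour t u j)
          (<⇒≢ i<j ∘ neighbour-injective t 3<t u i j)
          (punchOut-injective (none ∘ (i ,_)) (none ∘ (j ,_)) eq))

  ¬few-colours : ⊥
  ¬few-colours
    with i , fv≡0 ← some-neighbour-zero (+ 0)
    with j , fw≡0 ← some-neighbour-zero (neighbour t (+ 0) i)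
    = packing _ _ (Adj⇒≢ 3<t (neighbour-adj t (neighbour t (+ 0) i) j)) (trans (sym fw≡0) fv≡0)
        (1 , subst (λ c → 1 ≤ S122 (suc (toℕ c))) fw≡0 (s≤s z≤n)
           , step (neighbour-adj t (neighbour t (+ 0) i) j) here)

colours≥5 : ∀ {t} → 3 < t → ∀ k → HasSPackingColoring S122 t k → 5 ≤ k
colours≥5 3<t zero    (f , _) with () ← f (+ 0)
colours≥5 3<t (suc k) (f , packing) with 5 ≤? suc k
... | yes 5≤k = 5≤k
... | no  5≰k = contradiction (¬few-colours 3<t (s<s⁻¹ (≰⇒> 5≰k)) f packing) λ ()

-- Colourings described by differences

-- The signed form of `∣ i - j ∣ ≡ d`: matching on `refl` replaces one vertex by a shift of the
-- other by a natural number, the shape in which colours are compared.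
Apart : ℕ → ℤ → ℤ → Set
Apart d i j = i ≡ j ℤ.+ + d ⊎ j ≡ i ℤ.+ + d

∣i-j∣≡d⇒Apart : ∀ {d} i j → ∣ i ℤ.- j ∣ ≡ d → Apart d i j
∣i-j∣≡d⇒Apart i j refl with ℤ.+∣i∣≡i⊎+∣i∣≡-i (i ℤ.- j)
... | inj₁ eq = inj₁ (trans (i≡j+[i-j] i j) (cong (ℤ._+_ j) (sym eq)))
  where
  i≡j+[i-j] : ∀ i j → i ≡ j ℤ.+ (i ℤ.- j)
  i≡j+[i-j] = ℤSolver.solve-∀
... | inj₂ eq = inj₂ (trans (j≡i-[i-j] i j) (cong (ℤ._+_ i) (sym eq)))
  where
  j≡i-[i-j] : ∀ i j → j ≡ i ℤ.+ ℤ.- (i ℤ.- j)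
  j≡i-[i-j] = ℤSolver.solve-∀

-- Displacements in the same direction add; in opposite directions they cancel. Writing the second
-- as `d + s` keeps the difference `s` natural without subtraction.
Apart-trans : ∀ {d s i j k} → Apart d i j → Apart (d + s) j k →
              Apart (d + (d + s)) i k ⊎ Apart s i k
Apart-trans {d} {s} {k = k} (inj₁ refl) (inj₁ refl) = inj₁ (inj₁ (lemma k (+ d) (+ s)))
  where
  lemma : ∀ k d s → k ℤ.+ (d ℤ.+ s) ℤ.+ d ≡ k ℤ.+ (d ℤ.+ (d ℤ.+ s))
  lemma = ℤSolver.solve-∀
Apart-trans {d} {s} {j = j} (inj₁ refl) (inj₂ refl) = inj₂ (inj₂ (lemma j (+ d) (+ s)))
  where
  lemma : ∀ j d s → j ℤ.+ (d ℤ.+ s) ≡ j ℤ.+ d ℤ.+ s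
  lemma = ℤSolver.solve-∀
Apart-trans {d} {s} {i} {k = k} (inj₂ j≡i+d) (inj₁ j≡k+d+s) = inj₂ (inj₁
  (trans (sym (lemma₁ i (+ d))) (trans (cong (ℤ._- + d) (trans (sym j≡i+d) j≡k+d+s)) (lemma₂ k (+ d) (+ s)))))
  where
  lemma₁ : ∀ i d → i ℤ.+ d ℤ.- d ≡ i
  lemma₁ = ℤSolver.solve-∀
  lemma₂ : ∀ k d s → k ℤ.+ (d ℤ.+ s) ℤ.- d ≡ k ℤ.+ s
  lemma₂ = ℤSolver.solve-∀
Apart-trans {d} {s} {i} (inj₂ refl) (inj₂ refl) = inj₁ (inj₂ (ℤ.+-assoc i (+ d) (+ (d + s))))

-- The case `s = 0` of `Apart-trans`: cancellation would return to `i`, which `i ≢ k` excludes.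
Apart-twice : ∀ {d i j k} → Apart d i j → Apart d j k → i ≢ k → Apart (d + d) i k
Apart-twice {d} {i} {j} {k} p q i≢k
  with Apart-trans {d} {0} p (subst (λ e → Apart e j k) (+-comm 0 d) q)
... | inj₁ r        = subst (λ e → Apart (d + e) i k) (+-comm d 0) r
... | inj₂ (inj₁ e) = contradiction (trans e (ℤ.+-identityʳ k)) i≢k
... | inj₂ (inj₂ e) = contradiction (sym (trans e (ℤ.+-identityʳ i))) i≢k

Differs : (ℤ → Fin 5) → ℕ → Set
Differs f d = ∀ u → f u ≢ f (u ℤ.+ + d)

-- `zero` is the colour with bound 1, the only one that may recur at distance 2.
EqualOnlyAtZero : (ℤ → Fin 5) → ℕ → Set
EqualOnlyAtZero f d = ∀ u → f u ≡ f (u ℤ.+ + d) → f u ≡ zero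

differs⇒equalOnlyAtZero : ∀ {f d} → Differs f d → EqualOnlyAtZero f d
differs⇒equalOnlyAtZero differs u eq = contradiction eq (differs u)

-- Here `s` stands for t - 2, which avoids subtraction. The first two conditions concern single
-- edges; the other four cover the displacements of two-edge walks that do not return.
module _ {s} (f : ℤ → Fin 5)
         (differs-2   : Differs f 2)
         (differs-t   : Differs f (2 + s))
         (equal-4     : EqualOnlyAtZero f 4)
         (equal-[t-2] : EqualOnlyAtZero f s)
         (equal-[t+2] : EqualOnlyAtZero f (2 + (2 + s)))
         (equal-2t    : EqualOnlyAtZero f ((2 + s) + (2 + s))) where

  private
    Apart-differs : ∀ {d u v} → Differs f d → Apart d u v → f u ≢ f v
    Apart-differs {v = v} differs (inj₁ refl) eq = differs v (sym eq)
    Apart-differs {u = u} differs (inj₂ refl) eq = differs u eq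

    Apart-equal : ∀ {d u v} → EqualOnlyAtZero f d → Apart d u v → f u ≡ f v → f u ≡ zero
    Apart-equal {v = v} equal (inj₁ refl) eq = trans eq (equal v (sym eq))
    Apart-equal {u = u} equal (inj₂ refl) eq = equal u eq

    adj-differs : ∀ {u v} → Adj (2 + s) u v → f u ≢ f v
    adj-differs (inj₁ e) = Apart-differs differs-2 (∣i-j∣≡d⇒Apart _ _ e)
    adj-differs (inj₂ e) = Apart-differs differs-t (∣i-j∣≡d⇒Apart _ _ e)

    two-steps-equal : ∀ {u v w} → Adj (2 + s) u v → Adj (2 + s) v w → u ≢ w → f u ≡ f w → f u ≡ zero
    two-steps-equal {u} {v} {w} (inj₁ p) (inj₁ q) u≢w =
      Apart-equal equal-4 (Apart-twice (∣i-j∣≡d⇒Apart u v p) (∣i-j∣≡d⇒Apart v w q) u≢w)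
    two-steps-equal {u} {v} {w} (inj₂ p) (inj₂ q) u≢w =
      Apart-equal equal-2t (Apart-twice (∣i-j∣≡d⇒Apart u v p) (∣i-j∣≡d⇒Apart v w q) u≢w)
    two-steps-equal {u} {v} {w} (inj₁ p) (inj₂ q) _ =
      [ Apart-equal equal-[t+2] , Apart-equal equal-[t-2] ]′
        (Apart-trans (∣i-j∣≡d⇒Apart u v p) (∣i-j∣≡d⇒Apart v w q))
    two-steps-equal {u} {v} {w} (inj₂ p) (inj₁ q) _ =
      [ Apart-equal equal-[t+2] ∘ swap , Apart-equal equal-[t-2] ∘ swap ]′
        -- `Apart-trans` wants the step of length 2 first, so the walk is read backwards, from `w`
        -- to `u`.
        (Apart-trans (swap (∣i-j∣≡d⇒Apart v w q)) (swap (∣i-j∣≡d⇒Apart u v p)))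

  differences⇒packing : IsSPackingColoring S122 (2 + s) 5 f
  differences⇒packing u .u u≢u eq (_ , _ , here) = u≢u refl
  differences⇒packing u v  _   eq (_ , _ , step p here) = adj-differs p eq
  differences⇒packing u v  u≢v eq (_ , 2≤ , step p (step q here))
    -- Equal colours two edges apart must be `zero`, whose bound is 1; the walk of length 2 would
    -- then give 2 ≤ 1.
    with s≤s () ← subst (λ c → 2 ≤ S122 (suc (toℕ c))) (two-steps-equal p q u≢v eq) 2≤
  differences⇒packing u v  _   _  (_ , n≤ , step _ (step _ (step _ _)))
    with s≤s (s≤s ()) ← ≤-trans n≤ (S122≤2 (suc (toℕ (f u))))

-- Remainders of integers

-- A negative quotient is moved to the other side, so that for either sign of `q` the equation lives
-- in ℕ, with a multiple of `n` that the remainder ignores.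
%ℕ-unique : ∀ {a b n} .{{_ : NonZero n}} q → a < n → + a ℤ.+ q ℤ.* + n ≡ + b → a ≡ b % n
%ℕ-unique {a} {b} {n} (+ m) a<n eq = begin
  a                ≡⟨ m<n⇒m%n≡m a<n ⟨
  a % n            ≡⟨ [m+kn]%n≡m%n a m n ⟨
  (a + m * n) % n  ≡⟨ cong (_% n) (ℤ.+-injective (trans (cong (λ z → + a ℤ.+ z) (ℤ.pos-* m n)) eq)) ⟩
  b % n            ∎
  where open ≡-Reasoning
%ℕ-unique {a} {b} {n} -[1+ m ] a<n eq = begin
  a                    ≡⟨ m<n⇒m%n≡m a<n ⟨
  a % n                ≡⟨ cong (_% n) (ℤ.+-injective a≡b+[1+m]n) ⟩
  (b + suc m * n) % n  ≡⟨ [m+kn]%n≡m%n b (suc m) n ⟩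
  b % n                ∎
  where
  open ≡-Reasoning
  lemma : ∀ a k n → a ≡ (a ℤ.+ (ℤ.- k) ℤ.* n) ℤ.+ k ℤ.* n
  lemma = ℤSolver.solve-∀
  a≡b+[1+m]n : + a ≡ + (b + suc m * n)
  a≡b+[1+m]n = trans (lemma (+ a) (+ suc m) (+ n)) (cong₂ ℤ._+_ eq (sym (ℤ.pos-* (suc m) n)))

[i+k]%ℕn : ∀ i k n .{{_ : NonZero n}} → (i ℤ.+ + k) %ℕ n ≡ (i %ℕ n + k) % n
-- The witness is the difference of quotients that results from subtracting the division equation of
-- `i` from that of `i + k`.
[i+k]%ℕn i k n = %ℕ-unique (j /ℕ n ℤ.- i /ℕ n) (ℤ.n%ℕd<d j n) (begin
  + (j %ℕ n) ℤ.+ (j /ℕ n ℤ.- i /ℕ n) ℤ.* + n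
    ≡⟨ lemma₁ (+ (j %ℕ n)) (j /ℕ n) (i /ℕ n) (+ n) ⟩
  (+ (j %ℕ n) ℤ.+ j /ℕ n ℤ.* + n) ℤ.- i /ℕ n ℤ.* + n
    ≡⟨ cong (ℤ._- i /ℕ n ℤ.* + n) (ℤ.a≡a%ℕn+[a/ℕn]*n j n) ⟨
  (i ℤ.+ + k) ℤ.- i /ℕ n ℤ.* + n
    ≡⟨ cong (λ z → (z ℤ.+ + k) ℤ.- i /ℕ n ℤ.* + n) (ℤ.a≡a%ℕn+[a/ℕn]*n i n) ⟩
  ((+ (i %ℕ n) ℤ.+ i /ℕ n ℤ.* + n) ℤ.+ + k) ℤ.- i /ℕ n ℤ.* + n
    ≡⟨ lemma₂ (+ (i %ℕ n)) (i /ℕ n ℤ.* + n) (+ k) ⟩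
  + (i %ℕ n + k) ∎)
  where
  open ≡-Reasoning
  j = i ℤ.+ + k
  lemma₁ : ∀ a p q n → a ℤ.+ (p ℤ.- q) ℤ.* n ≡ (a ℤ.+ p ℤ.* n) ℤ.- q ℤ.* n
  lemma₁ = ℤSolver.solve-∀
  lemma₂ : ∀ a b k → ((a ℤ.+ b) ℤ.+ k) ℤ.- b ≡ a ℤ.+ k
  lemma₂ = ℤSolver.solve-∀

[h*[i+d]]%ℕn : ∀ h i {d k} m n .{{_ : NonZero n}} → h * d ≡ k + m * n →
               (+ h ℤ.* (i ℤ.+ + d)) %ℕ n ≡ ((+ h ℤ.* i) %ℕ n + k) % n
[h*[i+d]]%ℕn h i {d} {k} m n hd≡k+mn = begin
  (+ h ℤ.* (i ℤ.+ + d)) %ℕ n          ≡⟨ cong (_%ℕ n) (ℤ.*-distribˡ-+ (+ h) i (+ d)) ⟩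
  (+ h ℤ.* i ℤ.+ + h ℤ.* + d) %ℕ n    ≡⟨ cong (λ z → (+ h ℤ.* i ℤ.+ z) %ℕ n) (ℤ.pos-* h d) ⟨
  (+ h ℤ.* i ℤ.+ + (h * d)) %ℕ n      ≡⟨ [i+k]%ℕn (+ h ℤ.* i) (h * d) n ⟩
  (r + h * d) % n                     ≡⟨ cong (λ e → (r + e) % n) hd≡k+mn ⟩
  (r + (k + m * n)) % n               ≡⟨ cong (_% n) (+-assoc r k (m * n)) ⟨
  (r + k + m * n) % n                 ≡⟨ [m+kn]%n≡m%n (r + k) m n ⟩
  (r + k) % n                         ∎
  where
  open ≡-Reasoning
  r = (+ h ℤ.* i) %ℕ n

-- The word of period 6

letter : ℕ → Fin 5
letter 0 = 3F
letter 1 = 4F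
letter 2 = 0F
letter 3 = 1F
letter 4 = 2F
letter 5 = 0F
-- The period holds by computation, so the checks below need only six values and a recursive call.
letter (suc (suc (suc (suc (suc (suc r)))))) = letter r

letter-periodic : ∀ r m → letter (r + m * 6) ≡ letter r
letter-periodic r zero    = cong letter (+-comm r 0)
letter-periodic r (suc m) = trans (cong letter (lemma r m)) (letter-periodic r m)
  where
  lemma : ∀ r m → r + suc m * 6 ≡ 6 + (r + m * 6)
  lemma = ℕSolver.solve-∀

letter-%6 : ∀ r → letter (r % 6) ≡ letter r
letter-%6 r = trans (sym (letter-periodic (r % 6) (r / 6))) (cong letter (sym (m≡m%n+[m/n]*n r 6)))

letter-differs-1 : ∀ r → letter r ≢ letter (r + 1)
letter-differs-1 0 ()
letter-differs-1 1 ()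
letter-differs-1 2 ()
letter-differs-1 3 ()
letter-differs-1 4 ()
letter-differs-1 5 ()
letter-differs-1 (suc (suc (suc (suc (suc (suc r)))))) = letter-differs-1 r

letter-differs-2 : ∀ r → letter r ≢ letter (r + 2)
letter-differs-2 0 ()
letter-differs-2 1 ()
letter-differs-2 2 ()
letter-differs-2 3 ()
letter-differs-2 4 ()
letter-differs-2 5 ()
letter-differs-2 (suc (suc (suc (suc (suc (suc r)))))) = letter-differs-2 r

letter-differs-4 : ∀ r → letter r ≢ letter (r + 4)
letter-differs-4 0 ()
letter-differs-4 1 ()
letter-differs-4 2 ()
letter-differs-4 3 ()
letter-differs-4 4 ()
letter-differs-4 5 ()
letter-differs-4 (suc (suc (suc (suc (suc (suc r)))))) = letter-differs-4 r

letter-differs-5 : ∀ r → letter r ≢ letter (r + 5)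
letter-differs-5 0 ()
letter-differs-5 1 ()
letter-differs-5 2 ()
letter-differs-5 3 ()
letter-differs-5 4 ()
letter-differs-5 5 ()
letter-differs-5 (suc (suc (suc (suc (suc (suc r)))))) = letter-differs-5 r

-- Within a period only `zero` repeats, at positions 2 and 5. Both cyclic gaps are 3, so only
-- multiples of 3 can shift a letter to an equal one, unless they are multiples of 6.
letter-equal-3 : ∀ r → letter r ≡ letter (r + 3) → letter r ≡ zero
letter-equal-3 0 ()
letter-equal-3 1 ()
letter-equal-3 2 _ = refl
letter-equal-3 3 ()
letter-equal-3 4 ()
letter-equal-3 5 _ = refl
letter-equal-3 (suc (suc (suc (suc (suc (suc r)))))) = letter-equal-3 r

-- t ≡ ±1 (mod 6)

mod6 : ℤ → Fin 5
mod6 i = letter (i %ℕ 6)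

mod6-shift : ∀ {d} k m → d ≡ k + m * 6 → ∀ i → mod6 (i ℤ.+ + d) ≡ letter (i %ℕ 6 + k)
mod6-shift k m refl i = begin
  mod6 (i ℤ.+ + (k + m * 6))             ≡⟨ cong letter ([i+k]%ℕn i (k + m * 6) 6) ⟩
  letter ((i %ℕ 6 + (k + m * 6)) % 6)    ≡⟨ letter-%6 (i %ℕ 6 + (k + m * 6)) ⟩
  letter (i %ℕ 6 + (k + m * 6))          ≡⟨ cong letter (+-assoc (i %ℕ 6) k (m * 6)) ⟨
  letter (i %ℕ 6 + k + m * 6)            ≡⟨ letter-periodic (i %ℕ 6 + k) m ⟩
  letter (i %ℕ 6 + k)                    ∎
  where open ≡-Reasoning

mod6-differs : ∀ {d} k m → (∀ r → letter r ≢ letter (r + k)) → d ≡ k + m * 6 → Differs mod6 d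
mod6-differs k m differs eq i e = differs (i %ℕ 6) (trans e (mod6-shift k m eq i))

mod6-equal-3 : ∀ {d} m → d ≡ 3 + m * 6 → EqualOnlyAtZero mod6 d
mod6-equal-3 m eq i e = letter-equal-3 (i %ℕ 6) (trans e (mod6-shift 3 m eq i))

-- Modulo 6 the differences 2, t, 4, t - 2, t + 2, 2t are 2, 5, 4, 3, 1, 4; the single 3 falls on a
-- two-edge displacement, where `zero` may repeat.
coloring-t≡5 : ∀ b → HasSPackingColoring S122 (5 + b * 6) 5
coloring-t≡5 b = mod6 , differences⇒packing mod6
  (mod6-differs 2 0 letter-differs-2 refl)
  (mod6-differs 5 b letter-differs-5 refl)
  (differs⇒equalOnlyAtZero (mod6-differs 4 0 letter-differs-4 refl))
  (mod6-equal-3 b refl)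
  (differs⇒equalOnlyAtZero (mod6-differs 1 (suc b) letter-differs-1 refl))
  (differs⇒equalOnlyAtZero (mod6-differs 4 (1 + b + b) letter-differs-4 (lemma b)))
  where
  lemma : ∀ b → (5 + b * 6) + (5 + b * 6) ≡ 4 + (1 + b + b) * 6
  lemma = ℕSolver.solve-∀

-- The residues are now 2, 1, 4, 5, 3, 2, with the 3 at t + 2.
coloring-t≡1 : ∀ b → HasSPackingColoring S122 (7 + b * 6) 5
coloring-t≡1 b = mod6 , differences⇒packing mod6
  (mod6-differs 2 0 letter-differs-2 refl)
  (mod6-differs 1 (suc b) letter-differs-1 refl)
  (differs⇒equalOnlyAtZero (mod6-differs 4 0 letter-differs-4 refl))
  (differs⇒equalOnlyAtZero (mod6-differs 5 b letter-differs-5 refl))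
  (mod6-equal-3 (suc b) refl)
  (differs⇒equalOnlyAtZero (mod6-differs 2 (2 + b + b) letter-differs-2 (lemma b)))
  where
  lemma : ∀ b → (7 + b * 6) + (7 + b * 6) ≡ 2 + (2 + b + b) * 6
  lemma = ℕSolver.solve-∀

-- t ≡ 3 (mod 6)

module _ (b : ℕ) where

  private
    -- Period 6 fails for t ≡ 3 (mod 6): a shift by t would carry `zero` to `zero` along an edge.
    n h : ℕ
    n = 5 + b * 6
    h = 3 + b * 3

  -- Past the seam, `r + k` becomes `r′ = r + k - n`, and `r` is `r′ + (5 - k)` up to full periods.
  -- As `r′ < k`, both `r′` and `r′ + (5 - k)` lie in 0, ..., 4, where the letters 4 5 1 2 3 are
  -- distinct.
  letter-wrap : ∀ {r k} → k ≤ 4 → r < n → n ≤ r + k → letter r ≢ letter ((r + k) % n)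
  letter-wrap {r} {k} k≤4 r<n n≤r+k eq =
    distinct k r′ k≤4 r′<k (trans (sym letter-r) (trans eq letter-[r+k]%n))
    where
    open ≡-Reasoning
    r′ = r + k ∸ n

    r′+n≡r+k : r′ + n ≡ r + k
    r′+n≡r+k = m∸n+n≡m n≤r+k

    r′<k : r′ < k
    r′<k = +-cancelʳ-< n r′ k (subst (_< k + n) (sym r′+n≡r+k) (subst (_< k + n) (+-comm k r) (+-monoʳ-< k r<n)))

    5≡5∸k+k : ∀ {k} → k ≤ 4 → 5 ≡ 5 ∸ k + k
    5≡5∸k+k z≤n                         = refl
    5≡5∸k+k (s≤s z≤n)                   = refl
    5≡5∸k+k (s≤s (s≤s z≤n))             = refl
    5≡5∸k+k (s≤s (s≤s (s≤s z≤n)))       = refl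
    5≡5∸k+k (s≤s (s≤s (s≤s (s≤s z≤n)))) = refl

    regroup : ∀ r′ j k b → r′ + (j + k + b) ≡ r′ + j + b + k
    regroup = ℕSolver.solve-∀

    r≡ : r ≡ r′ + (5 ∸ k) + b * 6
    r≡ = +-cancelʳ-≡ k r _ (begin
      r + k                         ≡⟨ r′+n≡r+k ⟨
      r′ + (5 + b * 6)              ≡⟨ cong (λ e → r′ + (e + b * 6)) (5≡5∸k+k k≤4) ⟩
      r′ + (5 ∸ k + k + b * 6)      ≡⟨ regroup r′ (5 ∸ k) k (b * 6) ⟩
      r′ + (5 ∸ k) + b * 6 + k      ∎)

    letter-r : letter r ≡ letter (r′ + (5 ∸ k))
    letter-r = trans (cong letter r≡) (letter-periodic (r′ + (5 ∸ k)) b)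

    k<n : k < n
    k<n = s≤s (≤-trans k≤4 (m≤m+n 4 (b * 6)))

    letter-[r+k]%n : letter ((r + k) % n) ≡ letter r′
    letter-[r+k]%n = cong letter (begin
      (r + k) % n   ≡⟨ cong (_% n) r′+n≡r+k ⟨
      (r′ + n) % n  ≡⟨ [m+n]%n≡m%n r′ n ⟩
      r′ % n        ≡⟨ m<n⇒m%n≡m (<-trans r′<k k<n) ⟩
      r′            ∎)

    distinct : ∀ k r′ → k ≤ 4 → r′ < k → letter (r′ + (5 ∸ k)) ≢ letter r′
    distinct 1 0 _ _ ()
    distinct 2 0 _ _ ()
    distinct 2 1 _ _ ()
    distinct 3 0 _ _ ()
    distinct 3 1 _ _ ()
    distinct 3 2 _ _ ()
    distinct 4 0 _ _ ()
    distinct 4 1 _ _ ()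
    distinct 4 2 _ _ ()
    distinct 4 3 _ _ ()
    distinct 1 (suc _) _ (s≤s ())
    distinct 2 (suc (suc _)) _ (s≤s (s≤s ()))
    distinct 3 (suc (suc (suc _))) _ (s≤s (s≤s (s≤s ())))
    distinct 4 (suc (suc (suc (suc _)))) _ (s≤s (s≤s (s≤s (s≤s ()))))
    distinct (suc (suc (suc (suc (suc _))))) _ (s≤s (s≤s (s≤s (s≤s ()))))

  modN : ℤ → Fin 5
  modN i = letter ((+ h ℤ.* i) %ℕ n)

  -- If the position plus `k` stays below `n`, reduction does nothing; if it wraps, `letter-wrap`
  -- rules out equal colours. So the cyclic word inherits what holds for the periodic one.
  modN-shift : ∀ {d} k m → k ≤ 4 → h * d ≡ k + m * n → ∀ i → modN i ≡ modN (i ℤ.+ + d) →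
               letter ((+ h ℤ.* i) %ℕ n) ≡ letter ((+ h ℤ.* i) %ℕ n + k)
  modN-shift {d} k m k≤4 eq i e
    with r ← (+ h ℤ.* i) %ℕ n | r<n ← ℤ.n%ℕd<d (+ h ℤ.* i) n
       | shift ← [h*[i+d]]%ℕn h i {d} {k} m n eq
    with r + k <? n
  ... | yes r+k<n = trans e (cong letter (trans shift (m<n⇒m%n≡m r+k<n)))
  ... | no  r+k≮n = contradiction (trans e (cong letter shift)) (letter-wrap k≤4 r<n (≮⇒≥ r+k≮n))

  modN-differs : ∀ {d} k m → k ≤ 4 → (∀ r → letter r ≢ letter (r + k)) → h * d ≡ k + m * n → Differs modN d
  modN-differs k m k≤4 differs eq i e = differs ((+ h ℤ.* i) %ℕ n) (modN-shift k m k≤4 eq i e)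

  modN-equal-3 : ∀ {d} m → h * d ≡ 3 + m * n → EqualOnlyAtZero modN d
  modN-equal-3 m eq i e = letter-equal-3 ((+ h ℤ.* i) %ℕ n) (modN-shift 3 m (s≤s (s≤s (s≤s z≤n))) eq i e)

  -- Since t = n + 4, the differences are congruent to 2, 4, 4, 2, 6, 8 modulo `n`, and
  -- multiplication by `h` halves them. Arguments such as `5 + b * 3` are the quotients of `h * d`
  -- by `n`.
  coloring-t≡3 : HasSPackingColoring S122 (9 + b * 6) 5
  coloring-t≡3 = modN , differences⇒packing modN
    (modN-differs 1 1 1≤4 letter-differs-1 (h*2 b))
    (modN-differs 2 (5 + b * 3) 2≤4 letter-differs-2 (h*t b))
    (differs⇒equalOnlyAtZero (modN-differs 2 2 2≤4 letter-differs-2 (h*4 b)))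
    (differs⇒equalOnlyAtZero (modN-differs 1 (4 + b * 3) 1≤4 letter-differs-1 (h*[t-2] b)))
    (modN-equal-3 (6 + b * 3) (h*[t+2] b))
    (differs⇒equalOnlyAtZero (modN-differs 4 (10 + b * 6) ≤-refl letter-differs-4 (h*2t b)))
    where
    1≤4 : 1 ≤ 4
    1≤4 = s≤s z≤n
    2≤4 : 2 ≤ 4
    2≤4 = s≤s (s≤s z≤n)
    h*2 : ∀ b → (3 + b * 3) * 2 ≡ 1 + 1 * (5 + b * 6)
    h*2 = ℕSolver.solve-∀
    h*4 : ∀ b → (3 + b * 3) * 4 ≡ 2 + 2 * (5 + b * 6)
    h*4 = ℕSolver.solve-∀
    h*t : ∀ b → (3 + b * 3) * (9 + b * 6) ≡ 2 + (5 + b * 3) * (5 + b * 6)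
    h*t = ℕSolver.solve-∀
    h*[t-2] : ∀ b → (3 + b * 3) * (7 + b * 6) ≡ 1 + (4 + b * 3) * (5 + b * 6)
    h*[t-2] = ℕSolver.solve-∀
    h*[t+2] : ∀ b → (3 + b * 3) * (11 + b * 6) ≡ 3 + (6 + b * 3) * (5 + b * 6)
    h*[t+2] = ℕSolver.solve-∀
    h*2t : ∀ b → (3 + b * 3) * ((9 + b * 6) + (9 + b * 6)) ≡ 4 + (10 + b * 6) * (5 + b * 6)
    h*2t = ℕSolver.solve-∀

-- The residue of t modulo 6, and the conclusion

data OddAbove3 : ℕ → Set where
  ≡5mod6 : ∀ b → OddAbove3 (5 + b * 6)
  ≡1mod6 : ∀ b → OddAbove3 (7 + b * 6)
  ≡3mod6 : ∀ b → OddAbove3 (9 + b * 6)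

oddAbove3 : ∀ t → 3 < t → t % 2 ≡ 1 → OddAbove3 t
oddAbove3 1 (s≤s ())
oddAbove3 2 (s≤s (s≤s ()))
oddAbove3 3 (s≤s (s≤s (s≤s ())))
oddAbove3 4 _ ()
oddAbove3 5 _ _ = ≡5mod6 0
oddAbove3 6 _ ()
oddAbove3 7 _ _ = ≡1mod6 0
oddAbove3 8 _ ()
oddAbove3 9 _ _ = ≡3mod6 0
oddAbove3 (suc (suc (suc (suc (suc (suc t@(suc (suc (suc (suc m)))))))))) _ odd
  -- Parity and the three forms absorb six successors by computation, so `odd` passes unchanged and
  -- `b` grows by one. The four successors exposed in `t` supply its bound.
  with t | oddAbove3 t (s≤s (s≤s (s≤s (s≤s z≤n)))) odd
... | _ | ≡5mod6 b = ≡5mod6 (suc b)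
... | _ | ≡1mod6 b = ≡1mod6 (suc b)
... | _ | ≡3mod6 b = ≡3mod6 (suc b)

coloring : ∀ {t} → OddAbove3 t → HasSPackingColoring S122 t 5
coloring (≡5mod6 b) = coloring-t≡5 b
coloring (≡1mod6 b) = coloring-t≡1 b
coloring (≡3mod6 b) = coloring-t≡3 b

theorem4 : (t : ℕ) → 3 < t → t % 2 ≡ 1 → ChiSEq S122 t 5
theorem4 t 3<t odd = coloring (oddAbove3 t 3<t odd) , colours≥5 3<t
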